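{- Let $\mathscr{A}\subseteq\{(\mathsf 4),(\mathsf m),(\mathsf J)\}$ and let $\mathbf L=\mathbf K^+\cup\mathscr{A}$ be the corresponding strictly positive logic, with tree rewriting calculus $\mathsf T\mathbf L$. For all modal trees $T,T'\in\mathsf{Tree}^\diamond$, if $T\hookrightarrow^{*}_{\mathsf T\mathbf L}T'$, then $\mathcal F(T)\vdash_{\mathbf L}\mathcal F(T')$.
   Context: Formulas. Fix a set $\mathsf{Prop}$ of propositional variables. $\mathscr L^+$ is generated by $\varphi::=\top\mid p\mid\langle\alpha\rangle\varphi\mid(\varphi\wedge\varphi)$ with $p\in\mathsf{Prop}$, $\alpha\in\mathbb N$. Sequents are expressions $\varphi\vdash\psi$ with $\varphi,\psi\in\mathscr L^+$. For a finite list $\Pi$ of formulas, $\bigwedge\varnothing:=\top$ and $\bigwedge(\varphi\frown\hat\Pi):=\varphi\wedge\bigwedge\hat\Pi$. Logics. $\mathbf K^+$ has the axioms and rules: $\varphi\vdash\varphi$; $\varphi\vdash\top$; from $\varphi\vdash\psi$ and $\psi\vdash\phi$ infer $\varphi\vdash\phi$; $\varphi\wedge\psi\vdash\varphi$; $\varphi\wedge\psi\vdash\psi$; from $\varphi\vdash\psi$ and $\varphi\vdash\phi$ infer $\varphi\vdash\psi\wedge\phi$; from $\varphi\vdash\psi$ infer $\langle\alpha\rangle\varphi\vdash\langle\alpha\rangle\psi$. Additional axiom schemes: $(\mathsf 4)$ $\langle\alpha\rangle\langle\alpha\rangle\varphi\vdash\langle\alpha\rangle\varphi$; $(\mathsf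 m)$ $\langle\alpha\rangle\varphi\vdash\langle\beta\rangle\varphi$ for $\alpha>\beta$; $(\mathsf J)$ $\langle\alpha\rangle\varphi\wedge\langle\beta\rangle\psi\vdash\langle\alpha\rangle(\varphi\wedge\langle\beta\rangle\psi)$ for $\alpha>\beta$. $\mathbf K^+\cup\mathscr A$ is $\mathbf K^+$ extended with the axioms in $\mathscr A$; $\varphi\vdash_{\mathbf L}\psi$ means the sequent is provable in $\mathbf L$. Trees. $\varnothing$ is the empty list, $\frown$ is list concatenation (a single element is identified with the one-element list), $|L|$ is the length of $L$. The set $\mathsf{Tree}^\diamond$ of modal trees is defined inductively as the set of pairs $\langle\Delta;\Gamma\rangle$ with $\Delta$ a finite list of propositional variables and $\Gamma$ a finite list of pairs $(\alpha,T)$ with $\alpha\in\mathbb N$, $T\in\mathsf{Tree}^\diamond$. Positions are strings of positive integers ($\epsilon$ the empty string): for $T=\langle\Delta;[(\alpha_1,S_1),\dots,(\alpha_n,S_n)]\rangle$, $\mathsf{Pos}(T)=\{\epsilon\}\cup\bigcup_{i=1}^n\{i\mathbf k\mid\mathbf k\in\mathsf{Pos}(S_i)\}$. Subtree: $T|_\epsilon=T$, $T|_{i\mathbf r}=S_i|_{\mathbf r}$. Replacement: $T[S]_{\mathbf k}$ is $T$ with the subtree at position $\mathbf k$ replaced by $S$. Embedding $\mathcal F:\mathsf{Tree}^\diamond\to\mathscr L^+$: $\mathcal F(\langle\Delta;\Gamma\rangle):=\bigwedge\Delta\wedge\bigwedge[\langle\alpha\rangle\mathcal F(S)\mid(\alpha,S)\in\Gamma]$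 (the list is taken in the order of $\Gamma$). Rewriting rules. For $T\in\mathsf{Tree}^\diamond$, $\mathbf k\in\mathsf{Pos}(T)$ and $T|_{\mathbf k}=\langle\Delta;\Gamma\rangle$, a rule rewrites $T$ to $T[S']_{\mathbf k}$, where $S'$ is (all list indices within range): $\rho^+$: $\langle\Delta^{+i};\Gamma\rangle$, where $\Delta^{+i}$ is $\Delta$ with a copy of its $i$-th element prepended; $\rho^-$: $\Delta$ with its $i$-th element removed (same $\Gamma$); $\sigma$: $\Gamma$ with its $i$-th and $j$-th elements swapped, $i\ne j$ (same $\Delta$); $\pi^+$: $\Gamma$ with a copy of its $i$-th element prepended; $\pi^-$: $\Gamma$ with its $i$-th element removed; $\mathsf 4$: if the $i$-th element of $\Gamma$ is $(\beta,\langle\varnothing;[(\beta,S)]\rangle)$, replace it by $(\beta,S)$; $\mathsf m$: if the $i$-th element of $\Gamma$ is $(\alpha,S)$ and $\alpha>\beta$, replace it by $(\beta,S)$; $\mathsf J$: if the $i$-th element of $\Gamma$ is $(\alpha,\langle\tilde\Delta;\tilde\Gamma\rangle)$, the $j$-th element is $(\beta,S)$, $i\neq j$ and $\alpha>\beta$, replace the $i$-th element by $(\alpha,\langle\tilde\Delta;\tilde\Gamma\frown(\beta,S)\rangle)$ and remove the $j$-th element. The calculus $\mathsf T\mathbf L$ for $\mathbf L=\mathbf K^+\cup\mathscr A$ has the rules $\rho^+,\rho^-,\sigma,\pi^+,\pi^-$ together with the rule $\mu$ for each $(\mu)\in\mathscr A$. $\hookrightarrow_{\mathsf T\mathbf L}$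 is the union of its rules, and $\hookrightarrow^*_{\mathsf T\mathbf L}$ its reflexive transitive closure. -}

module Defs where

open import Data.Fin using (Fin; cast)
open import Data.Fin.Permutation.Components using (transpose)
open import Data.List using (List; []; _∷_; [_]; _++_; map; length; lookup; tabulate; removeAt; _[_]∷=_)
open import Data.List.Properties using (length-∷=)
open import Data.Nat using (ℕ; _>_)
open import Data.Product using (_×_; _,_; proj₁; proj₂)
open import Level using (Level; _⊔_)
open import Relation.Binary.Construct.Closure.ReflexiveTransitive using (Star)
open import Relation.Binary.PropositionalEquality using (_≡_; _≢_; sym)
open import Relation.Unary using (Pred)

private
  variable
    v a : Level
    Var : Set v

infixr 7 _∧_
infixr 8 ⟨_⟩_

data Formula (Var : Set v) : Set v where
  ⊤    : Formula Var
  var  : Var → Formula Var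
  ⟨_⟩_ : ℕ → Formula Var → Formula Var
  _∧_  : Formula Var → Formula Var → Formula Var

⋀ : List (Formula Var) → Formula Var
⋀ []      = ⊤
⋀ (φ ∷ Π) = φ ∧ ⋀ Π

-- Names for the additional axiom schemes; a logic K⁺ ∪ 𝒜 is given by a
-- predicate 𝒜 on them.
data Axiom : Set where
  ax4 axm axJ : Axiom

infix 4 K⁺∪_∶_⊢_

data K⁺∪_∶_⊢_ {Var : Set v} (𝒜 : Pred Axiom a) :
              Formula Var → Formula Var → Set (v ⊔ a) where
  id    : ∀ {φ} → K⁺∪ 𝒜 ∶ φ ⊢ φ
  top   : ∀ {φ} → K⁺∪ 𝒜 ∶ φ ⊢ ⊤
  cut   : ∀ {φ ψ χ} → K⁺∪ 𝒜 ∶ φ ⊢ ψ → K⁺∪ 𝒜 ∶ ψ ⊢ χ → K⁺∪ 𝒜 ∶ φ ⊢ χ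
  ∧-eˡ  : ∀ {φ ψ} → K⁺∪ 𝒜 ∶ φ ∧ ψ ⊢ φ
  ∧-eʳ  : ∀ {φ ψ} → K⁺∪ 𝒜 ∶ φ ∧ ψ ⊢ ψ
  ∧-i   : ∀ {φ ψ χ} → K⁺∪ 𝒜 ∶ φ ⊢ ψ → K⁺∪ 𝒜 ∶ φ ⊢ χ → K⁺∪ 𝒜 ∶ φ ⊢ ψ ∧ χ
  ◇-m   : ∀ {α φ ψ} → K⁺∪ 𝒜 ∶ φ ⊢ ψ → K⁺∪ 𝒜 ∶ ⟨ α ⟩ φ ⊢ ⟨ α ⟩ ψ
  four  : 𝒜 ax4 → ∀ {α φ} → K⁺∪ 𝒜 ∶ ⟨ α ⟩ ⟨ α ⟩ φ ⊢ ⟨ α ⟩ φ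
  mono  : 𝒜 axm → ∀ {α β φ} → α > β → K⁺∪ 𝒜 ∶ ⟨ α ⟩ φ ⊢ ⟨ β ⟩ φ
  J     : 𝒜 axJ → ∀ {α β φ ψ} → α > β →
          K⁺∪ 𝒜 ∶ ⟨ α ⟩ φ ∧ ⟨ β ⟩ ψ ⊢ ⟨ α ⟩ (φ ∧ ⟨ β ⟩ ψ)

data Tree◇ (Var : Set v) : Set v where
  ⟨_⨾_⟩ : List Var → List (ℕ × Tree◇ Var) → Tree◇ Var

-- Positions are intrinsically valid: the 0-based index i : Fin n stands for
-- the positive integer 1 + toℕ i.
data Pos {Var : Set v} : Tree◇ Var → Set v where
  ε   : ∀ {T} → Pos T
  _∷_ : ∀ {Δ Γ} (i : Fin (length Γ)) → Pos (proj₂ (lookup Γ i)) → Pos ⟨ Δ ⨾ Γ ⟩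

infix 9 _∣_

_∣_ : (T : Tree◇ Var) → Pos T → Tree◇ Var
T         ∣ ε       = T
⟨ Δ ⨾ Γ ⟩ ∣ (i ∷ k) = proj₂ (lookup Γ i) ∣ k

replace : (T : Tree◇ Var) → Pos T → Tree◇ Var → Tree◇ Var
replace T         ε       S = S
replace ⟨ Δ ⨾ Γ ⟩ (i ∷ k) S =
  ⟨ Δ ⨾ Γ [ i ]∷= (proj₁ (lookup Γ i) , replace (proj₂ (lookup Γ i)) k S) ⟩

-- 𝓕s is map (λ (α , S) → ⟨ α ⟩ 𝓕 S), inlined for the termination checker.
mutual
  𝓕 : Tree◇ Var → Formula Var
  𝓕 ⟨ Δ ⨾ Γ ⟩ = ⋀ (map var Δ) ∧ ⋀ (𝓕s Γ)

  𝓕s : List (ℕ × Tree◇ Var) → List (Formula Var)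
  𝓕s []            = []
  𝓕s ((α , S) ∷ Γ) = ⟨ α ⟩ 𝓕 S ∷ 𝓕s Γ

swapAt : {A : Set v} (xs : List A) (i j : Fin (length xs)) → List A
swapAt xs i j = tabulate (λ k → lookup xs (transpose i j k))

-- Both i and j index the original list; the cast only transports j along the
-- fact that overwriting an entry preserves the length.
setAt-removeAt : {A : Set v} (xs : List A) (i : Fin (length xs)) → A →
                 Fin (length xs) → List A
setAt-removeAt xs i x j =
  removeAt (xs [ i ]∷= x) (cast (sym (length-∷= xs i x)) j)

infix 4 TK⁺∪_∶_⇝_ TK⁺∪_∶_↪_ TK⁺∪_∶_↪*_

-- The rules as they act on the subtree at the chosen position.
data TK⁺∪_∶_⇝_ {Var : Set v} (𝒜 : Pred Axiom a) :
               Tree◇ Var → Tree◇ Var → Set (v ⊔ a) where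
  ρ⁺ : ∀ {Δ Γ} (i : Fin (length Δ)) →
       TK⁺∪ 𝒜 ∶ ⟨ Δ ⨾ Γ ⟩ ⇝ ⟨ lookup Δ i ∷ Δ ⨾ Γ ⟩
  ρ⁻ : ∀ {Δ Γ} (i : Fin (length Δ)) →
       TK⁺∪ 𝒜 ∶ ⟨ Δ ⨾ Γ ⟩ ⇝ ⟨ removeAt Δ i ⨾ Γ ⟩
  σ  : ∀ {Δ Γ} (i j : Fin (length Γ)) → i ≢ j →
       TK⁺∪ 𝒜 ∶ ⟨ Δ ⨾ Γ ⟩ ⇝ ⟨ Δ ⨾ swapAt Γ i j ⟩
  π⁺ : ∀ {Δ Γ} (i : Fin (length Γ)) →
       TK⁺∪ 𝒜 ∶ ⟨ Δ ⨾ Γ ⟩ ⇝ ⟨ Δ ⨾ lookup Γ i ∷ Γ ⟩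
  π⁻ : ∀ {Δ Γ} (i : Fin (length Γ)) →
       TK⁺∪ 𝒜 ∶ ⟨ Δ ⨾ Γ ⟩ ⇝ ⟨ Δ ⨾ removeAt Γ i ⟩
  four : 𝒜 ax4 → ∀ {Δ Γ β S} (i : Fin (length Γ)) →
         lookup Γ i ≡ (β , ⟨ [] ⨾ [ (β , S) ] ⟩) →
         TK⁺∪ 𝒜 ∶ ⟨ Δ ⨾ Γ ⟩ ⇝ ⟨ Δ ⨾ Γ [ i ]∷= (β , S) ⟩
  mono : 𝒜 axm → ∀ {Δ Γ α β S} (i : Fin (length Γ)) →
         lookup Γ i ≡ (α , S) → α > β →
         TK⁺∪ 𝒜 ∶ ⟨ Δ ⨾ Γ ⟩ ⇝ ⟨ Δ ⨾ Γ [ i ]∷= (β , S) ⟩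
  J : 𝒜 axJ → ∀ {Δ Γ Δ̃ Γ̃ α β S} (i j : Fin (length Γ)) →
      lookup Γ i ≡ (α , ⟨ Δ̃ ⨾ Γ̃ ⟩) → lookup Γ j ≡ (β , S) →
      i ≢ j → α > β →
      TK⁺∪ 𝒜 ∶ ⟨ Δ ⨾ Γ ⟩ ⇝
        ⟨ Δ ⨾ setAt-removeAt Γ i (α , ⟨ Δ̃ ⨾ Γ̃ ++ [ (β , S) ] ⟩) j ⟩

data TK⁺∪_∶_↪_ {Var : Set v} (𝒜 : Pred Axiom a) :
               Tree◇ Var → Tree◇ Var → Set (v ⊔ a) where
  at : ∀ {T S′} (k : Pos T) → TK⁺∪ 𝒜 ∶ T ∣ k ⇝ S′ →
       TK⁺∪ 𝒜 ∶ T ↪ replace T k S′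

TK⁺∪_∶_↪*_ : {Var : Set v} → Pred Axiom a → Tree◇ Var → Tree◇ Var → Set (v ⊔ a)
TK⁺∪ 𝒜 ∶ T ↪* T′ = Star (TK⁺∪ 𝒜 ∶_↪_) T T′

{-# OPTIONS --safe #-}
-- 𝓕 ⟨ Δ ⨾ Γ ⟩ is, up to provable equivalence, the conjunction of a set of
-- conjuncts, so the structural rules only use that no new entry is created.
-- Each modal rule creates one new entry, and this entry follows from the old
-- conjuncts by the axiom of the same name.
module Submission where

open import Defs
open import Data.Fin using (Fin; zero; suc; cast)
open import Data.Fin.Permutation.Components using (transpose)
open import Data.List using (List; []; _∷_; [_]; _++_; map; length; lookup; removeAt; _[_]∷=_)
open import Data.List.Membership.Propositional using (_∈_)
open import Data.List.Membership.Propositional.Properties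
  using (∈-lookup; ∈-tabulate⁻; ∈-++⁻)
open import Data.List.Properties using (length-∷=)
open import Data.List.Relation.Binary.Subset.Propositional using (_⊆_)
open import Data.List.Relation.Binary.Subset.Propositional.Properties using (∈-∷⁺ʳ; ⊆-refl)
open import Data.List.Relation.Unary.Any using (here; there)
open import Data.Nat using (ℕ)
open import Data.Product using (_×_; _,_; proj₂)
open import Data.Sum using (inj₁; inj₂)
open import Level using (Level)
open import Relation.Binary.Construct.Closure.ReflexiveTransitive using (fold)
open import Relation.Binary.PropositionalEquality using (refl; sym; subst)
open import Relation.Unary using (Pred)

private
  variable
    v a : Level
    A Var : Set v
    𝒜 : Pred Axiom a
    φ : Formula Var
    Δ Δ′ : List Var
    Γ Γ′ : List (ℕ × Tree◇ Var)
    e : ℕ × Tree◇ Var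

removeAt-⊆ : (xs : List A) (i : Fin (length xs)) → removeAt xs i ⊆ xs
removeAt-⊆ (x ∷ xs) zero    p         = there p
removeAt-⊆ (x ∷ xs) (suc i) (here p)  = here p
removeAt-⊆ (x ∷ xs) (suc i) (there p) = there (removeAt-⊆ xs i p)

-- The bound still contains the overwritten entry: only an upper bound on the new conjuncts matters,
-- so `y` can be treated as added in front.
∷=-⊆ : (xs : List A) (i : Fin (length xs)) (y : A) → xs [ i ]∷= y ⊆ y ∷ xs
∷=-⊆ (x ∷ xs) zero    y (here p)  = here p
∷=-⊆ (x ∷ xs) zero    y (there p) = there (there p)
∷=-⊆ (x ∷ xs) (suc i) y (here p)  = there (here p)
∷=-⊆ (x ∷ xs) (suc i) y (there p) with ∷=-⊆ xs i y p
... | here q  = here q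
... | there q = there (there q)

swapAt-⊆ : (xs : List A) (i j : Fin (length xs)) → swapAt xs i j ⊆ xs
swapAt-⊆ xs i j p
  with k , refl ← ∈-tabulate⁻ {f = λ k → lookup xs (transpose i j k)} p
  = ∈-lookup (transpose i j k)

setAt-removeAt-⊆ : (xs : List A) (i : Fin (length xs)) (y : A) (j : Fin (length xs)) →
                   setAt-removeAt xs i y j ⊆ y ∷ xs
setAt-removeAt-⊆ xs i y j p =
  -- `removeAt-⊆` holds at every index, so the `cast` needs no analysis.
  ∷=-⊆ xs i y (removeAt-⊆ (xs [ i ]∷= y) (cast (sym (length-∷= xs i y)) j) p)

-- Lets membership in `Γ` itself, rather than in `𝓕s Γ`, index the modal conjuncts.
◇ : ℕ × Tree◇ Var → Formula Var
◇ (α , S) = ⟨ α ⟩ 𝓕 S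

⋀-var : ∀ {x} → x ∈ Δ → K⁺∪ 𝒜 ∶ ⋀ (map var Δ) ⊢ var x
⋀-var (here refl) = ∧-eˡ
⋀-var (there p)   = cut ∧-eʳ (⋀-var p)

⋀-◇ : e ∈ Γ → K⁺∪ 𝒜 ∶ ⋀ (𝓕s Γ) ⊢ ◇ e
⋀-◇ (here refl)           = ∧-eˡ
⋀-◇ {Γ = _ ∷ _} (there p) = cut ∧-eʳ (⋀-◇ p)

⋀-var-intro : (Δ : List Var) → (∀ {x} → x ∈ Δ → K⁺∪ 𝒜 ∶ φ ⊢ var x) →
              K⁺∪ 𝒜 ∶ φ ⊢ ⋀ (map var Δ)
⋀-var-intro []      f = top
⋀-var-intro (x ∷ Δ) f = ∧-i (f (here refl)) (⋀-var-intro Δ (λ p → f (there p)))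

⋀-◇-intro : (Γ : List (ℕ × Tree◇ Var)) → (∀ {e} → e ∈ Γ → K⁺∪ 𝒜 ∶ φ ⊢ ◇ e) →
            K⁺∪ 𝒜 ∶ φ ⊢ ⋀ (𝓕s Γ)
⋀-◇-intro []      f = top
⋀-◇-intro (e ∷ Γ) f = ∧-i (f (here refl)) (⋀-◇-intro Γ (λ p → f (there p)))

𝓕-◇ : e ∈ Γ → K⁺∪ 𝒜 ∶ 𝓕 ⟨ Δ ⨾ Γ ⟩ ⊢ ◇ e
𝓕-◇ p = cut ∧-eʳ (⋀-◇ p)

𝓕-⊆ˡ : Δ′ ⊆ Δ → K⁺∪ 𝒜 ∶ 𝓕 ⟨ Δ ⨾ Γ ⟩ ⊢ 𝓕 ⟨ Δ′ ⨾ Γ ⟩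
𝓕-⊆ˡ s = ∧-i (cut ∧-eˡ (⋀-var-intro _ (λ p → ⋀-var (s p)))) ∧-eʳ

𝓕-⊆ʳ : Γ′ ⊆ Γ → K⁺∪ 𝒜 ∶ 𝓕 ⟨ Δ ⨾ Γ ⟩ ⊢ 𝓕 ⟨ Δ ⨾ Γ′ ⟩
𝓕-⊆ʳ s = ∧-i ∧-eˡ (⋀-◇-intro _ (λ p → 𝓕-◇ (s p)))

𝓕-add : (e : ℕ × Tree◇ Var) → K⁺∪ 𝒜 ∶ 𝓕 ⟨ Δ ⨾ Γ ⟩ ⊢ ◇ e → Γ′ ⊆ e ∷ Γ →
        K⁺∪ 𝒜 ∶ 𝓕 ⟨ Δ ⨾ Γ ⟩ ⊢ 𝓕 ⟨ Δ ⨾ Γ′ ⟩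
-- The cut formula is `𝓕 ⟨ Δ ⨾ e ∷ Γ ⟩` by definition.
𝓕-add e d s = cut (∧-i ∧-eˡ (∧-i d ∧-eʳ)) (𝓕-⊆ʳ s)

𝓕-set : (i : Fin (length Γ)) (e : ℕ × Tree◇ Var) →
        K⁺∪ 𝒜 ∶ ◇ (lookup Γ i) ⊢ ◇ e →
        K⁺∪ 𝒜 ∶ 𝓕 ⟨ Δ ⨾ Γ ⟩ ⊢ 𝓕 ⟨ Δ ⨾ Γ [ i ]∷= e ⟩
𝓕-set {Γ = Γ} i e d = 𝓕-add e (cut (𝓕-◇ (∈-lookup i)) d) (∷=-⊆ Γ i e)

-- Bridges the formula that axiom `J` leaves under the outer modality and the image of the enlarged
-- subtree, which differ in bracketing and order.
𝓕-snoc : K⁺∪ 𝒜 ∶ 𝓕 ⟨ Δ ⨾ Γ ⟩ ∧ ◇ e ⊢ 𝓕 ⟨ Δ ⨾ Γ ++ [ e ] ⟩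
𝓕-snoc {𝒜 = 𝒜} {Δ = Δ} {Γ = Γ} {e = e} = ∧-i (cut ∧-eˡ ∧-eˡ) (⋀-◇-intro _ conjunct)
  where
  conjunct : ∀ {e′} → e′ ∈ Γ ++ [ e ] → K⁺∪ 𝒜 ∶ 𝓕 ⟨ Δ ⨾ Γ ⟩ ∧ ◇ e ⊢ ◇ e′
  conjunct p with ∈-++⁻ Γ p
  ... | inj₁ q           = cut ∧-eˡ (𝓕-◇ q)
  ... | inj₂ (here refl) = ∧-eʳ

⇝-sound : ∀ {S S′ : Tree◇ Var} → TK⁺∪ 𝒜 ∶ S ⇝ S′ → K⁺∪ 𝒜 ∶ 𝓕 S ⊢ 𝓕 S′
⇝-sound (ρ⁺ i)            = 𝓕-⊆ˡ (∈-∷⁺ʳ (∈-lookup i) ⊆-refl)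
⇝-sound (ρ⁻ {Δ = Δ} i)    = 𝓕-⊆ˡ (removeAt-⊆ Δ i)
⇝-sound (σ {Γ = Γ} i j _) = 𝓕-⊆ʳ (swapAt-⊆ Γ i j)
⇝-sound (π⁺ i)            = 𝓕-⊆ʳ (∈-∷⁺ʳ (∈-lookup i) ⊆-refl)
⇝-sound (π⁻ {Γ = Γ} i)    = 𝓕-⊆ʳ (removeAt-⊆ Γ i)
⇝-sound {𝒜 = 𝒜} (four h {β = β} {S = S} i eq) =
  𝓕-set i (β , S)
    (subst (λ e → K⁺∪ 𝒜 ∶ ◇ e ⊢ ◇ (β , S)) (sym eq)
      -- The inner image is `⊤ ∧ (⟨ β ⟩ 𝓕 S ∧ ⊤)`; its padding is stripped under the outer modality
      -- before the axiom applies.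
      (cut (◇-m (𝓕-◇ (here refl))) (four h)))
⇝-sound {𝒜 = 𝒜} (mono h {β = β} {S = S} i eq α>β) =
  𝓕-set i (β , S)
    (subst (λ e → K⁺∪ 𝒜 ∶ ◇ e ⊢ ◇ (β , S)) (sym eq) (mono h α>β))
⇝-sound (J h {Γ = Γ} {Δ̃} {Γ̃} {α} {β} {S} i j eqᵢ eqⱼ _ α>β) =
  𝓕-add new
    -- Both premises of axiom `J` are read off the old `Γ`, where the `j`-th entry is still present.
    (cut (∧-i (𝓕-◇ (subst (_∈ Γ) eqᵢ (∈-lookup i)))
              (𝓕-◇ (subst (_∈ Γ) eqⱼ (∈-lookup j))))
         (cut (J h α>β) (◇-m 𝓕-snoc)))
    (setAt-removeAt-⊆ Γ i new j)
  where
  new : ℕ × Tree◇ _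
  new = α , ⟨ Δ̃ ⨾ Γ̃ ++ [ (β , S) ] ⟩

-- Every position lies under conjunctions and diamonds only, all monotone. Going up one level along
-- `k` keeps the label of the entry, so `◇-m` lifts the derivation.
replace-mono : (T : Tree◇ Var) (k : Pos T) {S : Tree◇ Var} →
               K⁺∪ 𝒜 ∶ 𝓕 (T ∣ k) ⊢ 𝓕 S → K⁺∪ 𝒜 ∶ 𝓕 T ⊢ 𝓕 (replace T k S)
replace-mono T         ε       d = d
replace-mono ⟨ Δ ⨾ Γ ⟩ (i ∷ k) d =
  𝓕-set i _ (◇-m (replace-mono (proj₂ (lookup Γ i)) k d))

↪-sound : ∀ {T T′ : Tree◇ Var} → TK⁺∪ 𝒜 ∶ T ↪ T′ → K⁺∪ 𝒜 ∶ 𝓕 T ⊢ 𝓕 T′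
↪-sound (at {T = T} k r) = replace-mono T k (⇝-sound r)

theorem4p9 : ∀ {v a} {Var : Set v} (𝒜 : Pred Axiom a) (T T′ : Tree◇ Var) →
    TK⁺∪ 𝒜 ∶ T ↪* T′ → K⁺∪ 𝒜 ∶ 𝓕 T ⊢ 𝓕 T′
theorem4p9 𝒜 T T′ = fold (λ T T′ → K⁺∪ 𝒜 ∶ 𝓕 T ⊢ 𝓕 T′) (λ r → cut (↪-sound r)) id
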